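{- For every integer $k\ge 1$, if $x,y>0$ are real numbers with $\max(x,y)=1/k$, then $\phi(x,y)=1/k$.
   Context: All graphs are finite, with no loops or multiple edges. $(0,1]$ is the set of reals $t$ with $0<t\le 1$. A tripartition of a graph $G$ is a partition $(A,B,C)$ of $V(G)$ into three nonempty stable (independent) sets. For $x,y\in(0,1]$, $G$ is $(x,y)$-constrained via a tripartition $(A,B,C)$ if every vertex in $A$ has at least $x|B|$ neighbours in $B$, every vertex in $B$ has at least $y|C|$ neighbours in $C$, and there are no edges between $A$ and $C$. $N^2(v)$ is the set of vertices at distance exactly two from $v$, and $N^2_A(v)=N^2(v)\cap A$. $\phi(x,y)$ is the maximum $z\in(0,1]$ (it exists) such that for every graph $G$ that is $(x,y)$-constrained via some $(A,B,C)$, there is a vertex $v\in C$ with $|N^2_A(v)|\ge z|A|$. -}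

module Defs where

open import Data.Fin.Base using (Fin)
open import Data.Fin.Properties using (any?) renaming (_≟_ to _≟ᶠ_)
open import Data.Fin.Subset
  using (Subset; _∈_; _∉_; Nonempty; Empty; _∩_; _∪_; ∣_∣; ⊤)
open import Data.Fin.Subset.Properties using (_∈?_)
open import Data.Integer.Base using (+_)
open import Data.Nat.Base as ℕ using (ℕ; zero; suc; NonZero)
import Data.Nat.Properties as ℕ
open import Data.Product.Base using (∃-syntax; _×_; _,_)
open import Data.Rational.Base as ℚ using (ℚ; 0ℚ; 1ℚ)
import Data.Rational.Properties as ℚ
open import Data.Rational.Solver using (module +-*-Solver)
open import Data.Sum.Base using (inj₁; inj₂)
open import Data.Vec.Base using (tabulate)
open import Relation.Binary.PropositionalEquality
  using (_≡_; refl; sym; trans; cong; subst; subst₂)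
open import Relation.Nullary.Decidable using (Dec; yes; no; does; map′; _×-dec_; ¬?)
open import Relation.Nullary.Negation using (¬_)

------------------------------------------------------------------------
-- Real numbers are Cauchy sequences of rationals (carrying a modulus, since ∃
-- is Σ); equality of reals is the setoid relation _≃_, not _≡_.

Cauchy : (ℕ → ℚ) → Set
Cauchy f = ∀ ε → 0ℚ ℚ.< ε →
  ∃[ N ] (∀ m n → N ℕ.≤ m → N ℕ.≤ n → ℚ.∣ f m ℚ.- f n ∣ ℚ.< ε)

record ℝ : Set where
  constructor mkℝ
  field
    seq    : ℕ → ℚ
    cauchy : Cauchy seq

open ℝ public

infix 4 _≃_ _≤_ _<_
infixl 6 _⊔_
infixl 7 _*_

_≃_ : ℝ → ℝ → Set
x ≃ y = ∀ ε → 0ℚ ℚ.< ε →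
  ∃[ N ] (∀ n → N ℕ.≤ n → ℚ.∣ seq x n ℚ.- seq y n ∣ ℚ.< ε)

_≤_ : ℝ → ℝ → Set
x ≤ y = ∀ ε → 0ℚ ℚ.< ε →
  ∃[ N ] (∀ n → N ℕ.≤ n → seq x n ℚ.≤ seq y n ℚ.+ ε)

_<_ : ℝ → ℝ → Set
x < y = ∃[ ε ] (0ℚ ℚ.< ε ×
  ∃[ N ] (∀ n → N ℕ.≤ n → seq x n ℚ.+ ε ℚ.≤ seq y n))

fromℚ : ℚ → ℝ
fromℚ q = mkℝ (λ _ → q) λ ε ε>0 →
  0 , λ _ _ _ _ → subst (λ p → ℚ.∣ p ∣ ℚ.< ε) (sym (ℚ.+-inverseʳ q)) ε>0

fromℕ : ℕ → ℝ
fromℕ n = fromℚ (+ n ℚ./ 1)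

0ℝ 1ℝ : ℝ
0ℝ = fromℚ 0ℚ
1ℝ = fromℚ 1ℚ

private
  open +-*-Solver

  q+[p-q] : ∀ p q → q ℚ.+ (p ℚ.- q) ≡ p
  q+[p-q] = solve 2 (λ p q → q :+ (p :- q) := p) refl

  [q+ε]-q : ∀ q ε → (q ℚ.+ ε) ℚ.- q ≡ ε
  [q+ε]-q = solve 2 (λ q ε → (q :+ ε) :- q := ε) refl

  -[p-q] : ∀ p q → ℚ.- (p ℚ.- q) ≡ q ℚ.- p
  -[p-q] = solve 2 (λ p q → :- (p :- q) := q :- p) refl

  ab-cd : ∀ a b c d →
    a ℚ.* b ℚ.- c ℚ.* d ≡ a ℚ.* (b ℚ.- d) ℚ.+ d ℚ.* (a ℚ.- c)
  ab-cd = solve 4 (λ a b c d →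
    a :* b :- c :* d := a :* (b :- d) :+ d :* (a :- c)) refl

  s[ei] : ∀ s e i → s ℚ.* (e ℚ.* i) ≡ e ℚ.* (s ℚ.* i)
  s[ei] = solve 3 (λ s e i → s :* (e :* i) := e :* (s :* i)) refl

  p≤∣p∣ : ∀ p → p ℚ.≤ ℚ.∣ p ∣
  p≤∣p∣ p with ℚ.≤-total 0ℚ p
  ... | inj₁ 0≤p = ℚ.≤-reflexive (sym (ℚ.0≤p⇒∣p∣≡p 0≤p))
  ... | inj₂ p≤0 = ℚ.≤-trans p≤0 (ℚ.0≤∣p∣ p)

  -<⇒<+ : ∀ {p q ε} → p ℚ.- q ℚ.< ε → p ℚ.< q ℚ.+ ε
  -<⇒<+ {p} {q} {ε} h = subst₂ ℚ._<_
    (q+[p-q] p q) refl (ℚ.+-monoʳ-< q h)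

  <+⇒-< : ∀ {p q ε} → p ℚ.< q ℚ.+ ε → p ℚ.- q ℚ.< ε
  <+⇒-< {p} {q} {ε} h = subst₂ ℚ._<_ refl
    ([q+ε]-q q ε) (ℚ.+-monoˡ-< (ℚ.- q) h)

  ∣-∣<⇒<+ : ∀ {p q ε} → ℚ.∣ p ℚ.- q ∣ ℚ.< ε → p ℚ.< q ℚ.+ ε
  ∣-∣<⇒<+ {p} {q} h = -<⇒<+ {p} {q} (ℚ.≤-<-trans (p≤∣p∣ (p ℚ.- q)) h)

  <+⇒∣-∣< : ∀ {p q ε} → p ℚ.< q ℚ.+ ε → q ℚ.< p ℚ.+ ε → ℚ.∣ p ℚ.- q ∣ ℚ.< ε
  <+⇒∣-∣< {p} {q} {ε} h₁ h₂ with ℚ.∣p∣≡p∨∣p∣≡-p (p ℚ.- q)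
  ... | inj₁ eq = subst (ℚ._< ε) (sym eq) (<+⇒-< {p} {q} h₁)
  ... | inj₂ eq = subst (ℚ._< ε)
    (sym (trans eq (-[p-q] p q)))
    (<+⇒-< {q} {p} h₂)

  ⊔-<+ : ∀ {p q r s ε} → p ℚ.< r ℚ.+ ε → q ℚ.< s ℚ.+ ε →
         p ℚ.⊔ q ℚ.< (r ℚ.⊔ s) ℚ.+ ε
  ⊔-<+ {p} {q} {r} {s} {ε} h₁ h₂ with ℚ.⊔-sel p q
  ... | inj₁ eq = subst (ℚ._< _) (sym eq)
    (ℚ.<-≤-trans h₁ (ℚ.+-monoˡ-≤ ε (ℚ.p≤p⊔q r s)))
  ... | inj₂ eq = subst (ℚ._< _) (sym eq)
    (ℚ.<-≤-trans h₂ (ℚ.+-monoˡ-≤ ε (ℚ.p≤q⊔p r s)))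

  ⊔-cauchy : ∀ {f g} → Cauchy f → Cauchy g → Cauchy (λ n → f n ℚ.⊔ g n)
  ⊔-cauchy {f} {g} cf cg ε ε>0 with cf ε ε>0 | cg ε ε>0
  ... | M , hf | N , hg = M ℕ.⊔ N , λ m n m≥ n≥ →
    let mM = ℕ.m⊔n≤o⇒m≤o M N m≥ ; mN = ℕ.m⊔n≤o⇒n≤o M N m≥
        nM = ℕ.m⊔n≤o⇒m≤o M N n≥ ; nN = ℕ.m⊔n≤o⇒n≤o M N n≥
    in <+⇒∣-∣< {f m ℚ.⊔ g m} {f n ℚ.⊔ g n}
      (⊔-<+ {f m} {g m} {f n} {g n}
        (∣-∣<⇒<+ {f m} {f n} (hf m n mM nM)) (∣-∣<⇒<+ {g m} {g n} (hg m n mN nN)))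
      (⊔-<+ {f n} {g n} {f m} {g m}
        (∣-∣<⇒<+ {f n} {f m} (hf n m nM mM)) (∣-∣<⇒<+ {g n} {g m} (hg n m nN mN)))

  EventuallyBounded : (ℕ → ℚ) → Set
  EventuallyBounded f =
    ∃[ K ] (0ℚ ℚ.< K × ∃[ N ] (∀ n → N ℕ.≤ n → ℚ.∣ f n ∣ ℚ.< K))

  cauchy⇒bounded : ∀ {f} → Cauchy f → EventuallyBounded f
  cauchy⇒bounded {f} cf with cf 1ℚ (ℚ.positive⁻¹ 1ℚ)
  ... | N , h = ℚ.∣ f N ∣ ℚ.+ 1ℚ , K>0 , N , bound
    where
    K>0 : 0ℚ ℚ.< ℚ.∣ f N ∣ ℚ.+ 1ℚ
    K>0 = ℚ.+-mono-≤-< (ℚ.0≤∣p∣ (f N)) (ℚ.positive⁻¹ 1ℚ)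

    bound : ∀ n → N ℕ.≤ n → ℚ.∣ f n ∣ ℚ.< ℚ.∣ f N ∣ ℚ.+ 1ℚ
    bound n n≥ = ℚ.≤-<-trans
      (subst (λ p → ℚ.∣ p ∣ ℚ.≤ ℚ.∣ f N ∣ ℚ.+ ℚ.∣ f n ℚ.- f N ∣)
        (q+[p-q] (f n) (f N))
        (ℚ.∣p+q∣≤∣p∣+∣q∣ (f N) (f n ℚ.- f N)))
      (ℚ.+-monoʳ-< ℚ.∣ f N ∣ (h n N n≥ ℕ.≤-refl))

  *-diff : ∀ a b c d {K L δ} → 0ℚ ℚ.< δ →
    ℚ.∣ a ∣ ℚ.< K → ℚ.∣ d ∣ ℚ.< L →
    ℚ.∣ a ℚ.- c ∣ ℚ.< δ → ℚ.∣ b ℚ.- d ∣ ℚ.< δ →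
    ℚ.∣ a ℚ.* b ℚ.- c ℚ.* d ∣ ℚ.< (K ℚ.+ L) ℚ.* δ
  *-diff a b c d {K} {L} {δ} δ>0 ∣a∣<K ∣d∣<L ∣a-c∣<δ ∣b-d∣<δ = begin-strict
    ℚ.∣ a ℚ.* b ℚ.- c ℚ.* d ∣
      ≡⟨ cong ℚ.∣_∣ (ab-cd a b c d) ⟩
    ℚ.∣ a ℚ.* (b ℚ.- d) ℚ.+ d ℚ.* (a ℚ.- c) ∣
      ≤⟨ ℚ.∣p+q∣≤∣p∣+∣q∣ (a ℚ.* (b ℚ.- d)) (d ℚ.* (a ℚ.- c)) ⟩
    ℚ.∣ a ℚ.* (b ℚ.- d) ∣ ℚ.+ ℚ.∣ d ℚ.* (a ℚ.- c) ∣
      <⟨ ℚ.+-mono-< (term a (b ℚ.- d) ∣a∣<K ∣b-d∣<δ) (term d (a ℚ.- c) ∣d∣<L ∣a-c∣<δ) ⟩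
    K ℚ.* δ ℚ.+ L ℚ.* δ
      ≡⟨ sym (ℚ.*-distribʳ-+ δ K L) ⟩
    (K ℚ.+ L) ℚ.* δ ∎
    where
    open ℚ.≤-Reasoning

    term : ∀ p q {M} → ℚ.∣ p ∣ ℚ.< M → ℚ.∣ q ∣ ℚ.< δ → ℚ.∣ p ℚ.* q ∣ ℚ.< M ℚ.* δ
    term p q {M} ∣p∣<M ∣q∣<δ = begin-strict
      ℚ.∣ p ℚ.* q ∣         ≡⟨ ℚ.∣p*q∣≡∣p∣*∣q∣ p q ⟩
      ℚ.∣ p ∣ ℚ.* ℚ.∣ q ∣   ≤⟨ ℚ.*-monoˡ-≤-nonNeg ℚ.∣ p ∣ {{ℚ.∣-∣-nonNeg p}} (ℚ.<⇒≤ ∣q∣<δ) ⟩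
      ℚ.∣ p ∣ ℚ.* δ         <⟨ ℚ.*-monoˡ-<-pos δ {{ℚ.positive δ>0}} ∣p∣<M ⟩
      M ℚ.* δ               ∎

  divide : ∀ S ε → 0ℚ ℚ.< S → 0ℚ ℚ.< ε → ∃[ δ ] (0ℚ ℚ.< δ × S ℚ.* δ ≡ ε)
  divide S ε S>0 ε>0 = ε ℚ.* i , δ>0 , Sδ≡ε
    where
    instance
      S-pos : ℚ.Positive S
      S-pos = ℚ.positive S>0

    S-nonZero : ℚ.NonZero S
    S-nonZero = ℚ.pos⇒nonZero S

    i : ℚ
    i = ℚ.1/_ S {{S-nonZero}}

    δ>0 : 0ℚ ℚ.< ε ℚ.* i
    δ>0 = ℚ.positive⁻¹ (ε ℚ.* i)
      {{ℚ.pos*pos⇒pos ε {{ℚ.positive ε>0}} i {{ℚ.1/pos⇒pos S}}}}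

    Sδ≡ε : S ℚ.* (ε ℚ.* i) ≡ ε
    Sδ≡ε = trans (s[ei] S ε i)
      (trans (cong (ε ℚ.*_) (ℚ.*-inverseʳ S {{S-nonZero}})) (ℚ.*-identityʳ ε))

  *-cauchy : ∀ {f g} → Cauchy f → Cauchy g → Cauchy (λ n → f n ℚ.* g n)
  *-cauchy {f} {g} cf cg ε ε>0 =
    let K , K>0 , Nf , bf = cauchy⇒bounded cf
        L , L>0 , Ng , bg = cauchy⇒bounded cg
        δ , δ>0 , [K+L]δ≡ε = divide (K ℚ.+ L) ε (ℚ.+-mono-< K>0 L>0) ε>0
        Mf , δf = cf δ δ>0
        Mg , δg = cg δ δ>0
    in (Nf ℕ.⊔ Ng) ℕ.⊔ (Mf ℕ.⊔ Mg) , λ m n m≥ n≥ →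
      let lm = ℕ.m⊔n≤o⇒m≤o (Nf ℕ.⊔ Ng) (Mf ℕ.⊔ Mg) m≥
          rm = ℕ.m⊔n≤o⇒n≤o (Nf ℕ.⊔ Ng) (Mf ℕ.⊔ Mg) m≥
          ln = ℕ.m⊔n≤o⇒m≤o (Nf ℕ.⊔ Ng) (Mf ℕ.⊔ Mg) n≥
          rn = ℕ.m⊔n≤o⇒n≤o (Nf ℕ.⊔ Ng) (Mf ℕ.⊔ Mg) n≥
      in subst (ℚ.∣ f m ℚ.* g m ℚ.- f n ℚ.* g n ∣ ℚ.<_) [K+L]δ≡ε
        (*-diff (f m) (g m) (f n) (g n) {K} {L} {δ} δ>0
          (bf m (ℕ.m⊔n≤o⇒m≤o Nf Ng lm)) (bg n (ℕ.m⊔n≤o⇒n≤o Nf Ng ln))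
          (δf m n (ℕ.m⊔n≤o⇒m≤o Mf Mg rm) (ℕ.m⊔n≤o⇒m≤o Mf Mg rn))
          (δg m n (ℕ.m⊔n≤o⇒n≤o Mf Mg rm) (ℕ.m⊔n≤o⇒n≤o Mf Mg rn)))

_⊔_ : ℝ → ℝ → ℝ
x ⊔ y = mkℝ (λ n → seq x n ℚ.⊔ seq y n) (⊔-cauchy {seq x} {seq y} (cauchy x) (cauchy y))

_*_ : ℝ → ℝ → ℝ
x * y = mkℝ (λ n → seq x n ℚ.* seq y n) (*-cauchy {seq x} {seq y} (cauchy x) (cauchy y))

1/ℕ : (k : ℕ) .{{_ : NonZero k}} → ℝ
1/ℕ k = fromℚ (+ 1 ℚ./ k)

_∈⟨0,1] : ℝ → Set
x ∈⟨0,1] = 0ℝ < x × x ≤ 1ℝ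

------------------------------------------------------------------------
-- Finite simple graphs, presented by the neighbourhood N v of each vertex v.

record Graph : Set where
  field
    order     : ℕ
    N         : Fin order → Subset order
    symmetric : ∀ {u v} → u ∈ N v → v ∈ N u
    loopless  : ∀ {v} → v ∉ N v

module _ (G : Graph) where
  open Graph G

  Vertex : Set
  Vertex = Fin order

  data Walk : ℕ → Vertex → Vertex → Set where
    nil  : ∀ {u} → Walk 0 u u
    cons : ∀ {ℓ u v w} → v ∈ N u → Walk ℓ v w → Walk (suc ℓ) u w

  AtDistance : ℕ → Vertex → Vertex → Set
  AtDistance d u v = Walk d u v × (∀ {ℓ} → ℓ ℕ.< d → ¬ Walk ℓ u v)

  walk? : ∀ ℓ u v → Dec (Walk ℓ u v)
  walk? zero    u v = map′ (λ { refl → nil }) (λ { nil → refl }) (u ≟ᶠ v)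
  walk? (suc ℓ) u w = map′
    (λ { (v , e , p) → cons e p }) (λ { (cons {v = v} e p) → v , e , p })
    (any? λ v → (v ∈? N u) ×-dec walk? ℓ v w)

  atDistance? : ∀ d u v → Dec (AtDistance d u v)
  atDistance? d u v = walk? d u v ×-dec ℕ.allUpTo? (λ ℓ → ¬? (walk? ℓ u v)) d

  N² : Vertex → Subset order
  N² v = tabulate λ u → does (atDistance? 2 v u)

  Stable : Subset order → Set
  Stable S = ∀ {u v} → u ∈ S → v ∈ S → v ∉ N u

  record Tripartition (A B C : Subset order) : Set where
    field
      A-nonempty : Nonempty A
      B-nonempty : Nonempty B
      C-nonempty : Nonempty C
      A∩B-empty  : Empty (A ∩ B)
      A∩C-empty  : Empty (A ∩ C)
      B∩C-empty  : Empty (B ∩ C)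
      cover      : A ∪ B ∪ C ≡ ⊤
      A-stable   : Stable A
      B-stable   : Stable B
      C-stable   : Stable C

  record Constrained (x y : ℝ) (A B C : Subset order) : Set where
    field
      tripartition : Tripartition A B C
      A-to-B       : ∀ {a} → a ∈ A → x * fromℕ ∣ B ∣ ≤ fromℕ ∣ N a ∩ B ∣
      B-to-C       : ∀ {b} → b ∈ B → y * fromℕ ∣ C ∣ ≤ fromℕ ∣ N b ∩ C ∣
      no-A-C-edges : ∀ {a c} → a ∈ A → c ∈ C → c ∉ N a

Admissible : ℝ → ℝ → ℝ → Set
Admissible x y z = ∀ (G : Graph) (A B C : Subset (Graph.order G)) →
  Constrained G x y A B C →
  ∃[ v ] (v ∈ C × z * fromℕ ∣ A ∣ ≤ fromℕ ∣ N² G v ∩ A ∣)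

infix 4 φ[_,_]≡_

-- φ as a relation: φ[ x , y ]≡ z says that the maximum defining φ(x,y)
-- exists and equals z.
record φ[_,_]≡_ (x y z : ℝ) : Set where
  field
    in-range   : z ∈⟨0,1]
    admissible : Admissible x y z
    maximal    : ∀ z′ → z′ ∈⟨0,1] → Admissible x y z′ → z′ ≤ z

{-# OPTIONS --safe #-}

-- Lower bound: count pairs.  If x = 1/k, then some b ∈ B has at least |A|/k
-- neighbours in A, and any neighbour of b in C is at distance two from all of
-- them; if y = 1/k, then every a ∈ A is at distance two from at least |C|/k
-- vertices of C, so some c ∈ C is at distance two from at least |A|/k vertices
-- of A.  Which of x and y equals 1/k is undecidable, but for a given graph it is
-- enough to know which one exceeds a rational slightly below 1/k, because the
-- degree conditions compare integers.
--
-- Upper bound: k disjoint paths a – b – c.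
module Submission where

open import Defs
open import Data.Bool.Base using (true; false; if_then_else_; _∧_)
open import Data.Fin.Base using (Fin; zero; suc; combine; remQuot; toℕ)
open import Data.Fin.Patterns using (0F; 1F; 2F)
open import Data.Fin.Properties using (any?; combine-remQuot; remQuot-combine) renaming (_≟_ to _≟ᶠ_)
open import Data.Fin.Subset using (Subset; _∈_; _∉_; _⊆_; Nonempty; Empty; _∩_; _∪_; ∣_∣; ⊤; ⁅_⁆)
open import Data.Fin.Subset.Properties
open import Data.Integer.Base as ℤ using (+_; +≤+; +<+)
import Data.Integer.Properties as ℤ
open import Data.Nat.Base as ℕ using (ℕ; zero; suc; NonZero)
import Data.Nat.Properties as ℕ
open import Data.Product.Base using (∃-syntax; _×_; _,_; proj₁; proj₂)
open import Data.Rational.Base as ℚ using (ℚ; 0ℚ; 1ℚ; ½; toℚᵘ)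
import Data.Rational.Properties as ℚ
open import Data.Rational.Solver using (module +-*-Solver)
open import Data.Rational.Unnormalised.Base as ℚᵘ using (mkℚᵘ; *≡*; *≤*; *<*)
import Data.Rational.Unnormalised.Properties as ℚᵘ
open import Data.Sum.Base using (_⊎_; inj₁; inj₂; [_,_]′)
open import Data.Vec.Base using ([]; _∷_; _++_; concat; lookup; map; replicate; tabulate)
open import Data.Vec.Properties
  using (lookup-zipWith; lookup∘tabulate; []=⇒lookup; lookup⇒[]=; lookup-concat; lookup-map; lookup-replicate)
open import Function.Base using (_∘_; case_of_)
open import Relation.Binary.PropositionalEquality
open import Relation.Nullary.Decidable using (yes; no; does; _×-dec_; dec-true)
open import Relation.Nullary.Negation using (¬_; contradiction)
open import Relation.Unary using (Decidable)

open import Algebra.Properties.Semiring.Sum ℕ.+-*-semiring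
  using (sum; sum-syntax; sum-cong-≗; ∑-comm; ∑-distrib-+; *-distribˡ-sum; *-distribʳ-sum)
open +-*-Solver using (solve; con; _:+_; _:*_; _:-_; :-_; _:=_)

-- Double counting

χ : ∀ {n} → Subset n → Fin n → ℕ
χ p i = if lookup p i then 1 else 0

∣p∣≡∑χ : ∀ {n} (p : Subset n) → ∣ p ∣ ≡ ∑[ i < n ] χ p i
∣p∣≡∑χ []          = refl
∣p∣≡∑χ (true  ∷ p) = cong suc (∣p∣≡∑χ p)
∣p∣≡∑χ (false ∷ p) = ∣p∣≡∑χ p

χ-∩ : ∀ {n} (p q : Subset n) i → χ (p ∩ q) i ≡ χ p i ℕ.* χ q i
χ-∩ p q i = trans
  (cong (if_then 1 else 0) (lookup-zipWith _∧_ i p q))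
  (lemma (lookup p i) (lookup q i))
  where
  lemma : ∀ a b → (if a ∧ b then 1 else 0) ≡ (if a then 1 else 0) ℕ.* (if b then 1 else 0)
  lemma true  true  = refl
  lemma true  false = refl
  lemma false b     = refl

χ-sym : ∀ {m n} {p : Subset m} {q : Subset n} {i j} →
        (i ∈ p → j ∈ q) → (j ∈ q → i ∈ p) → χ p i ≡ χ q j
χ-sym {p = p} {q} {i} {j} to from with lookup p i in eqₚ | lookup q j in eq
... | true  | true  = refl
... | false | false = refl
... | true  | false with () ← trans (sym eq) ([]=⇒lookup (to (lookup⇒[]= i p eqₚ)))
... | false | true  with () ← trans (sym eqₚ) ([]=⇒lookup (from (lookup⇒[]= j q eq)))

sum-mono-≤ : ∀ {n} {f g : Fin n → ℕ} → (∀ i → f i ℕ.≤ g i) → sum f ℕ.≤ sum g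
sum-mono-≤ {zero}  f≤g = ℕ.z≤n
sum-mono-≤ {suc n} f≤g = ℕ.+-mono-≤ (f≤g zero) (sum-mono-≤ (f≤g ∘ suc))

-- The bound is only needed on members of `p`, since `χ p` annihilates all other terms.
weighted-mono : ∀ {n} (p : Subset n) {f g : Fin n → ℕ} →
                (∀ {i} → i ∈ p → f i ℕ.≤ g i) →
                ∑[ i < n ] (χ p i ℕ.* f i) ℕ.≤ ∑[ i < n ] (χ p i ℕ.* g i)
weighted-mono p {f} {g} f≤g = sum-mono-≤ pointwise
  where
  pointwise : ∀ i → χ p i ℕ.* f i ℕ.≤ χ p i ℕ.* g i
  pointwise i with lookup p i in eq
  ... | true  = ℕ.*-monoʳ-≤ 1 (f≤g (lookup⇒[]= i p eq))
  ... | false = ℕ.z≤n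

∑χ*c : ∀ {n} (p : Subset n) c → ∑[ i < n ] (χ p i ℕ.* c) ≡ ∣ p ∣ ℕ.* c
∑χ*c p c = trans (sym (*-distribʳ-sum c (χ p))) (cong (ℕ._* c) (sym (∣p∣≡∑χ p)))

nonempty⇒0<∣p∣ : ∀ {n} {p : Subset n} → Nonempty p → 0 ℕ.< ∣ p ∣
nonempty⇒0<∣p∣ (_ , x∈p) = ℕ.≤-<-trans ℕ.z≤n (x∈p⇒∣p-x∣<∣p∣ x∈p)

module _ {n} (M : Fin n → Subset n) where

  -- Pairs of `S` × `T` related by `M`, counted from the side of `S`. `M` stays abstract because the
  -- averaging below is applied both to `N` and to `N²`.
  edges : Subset n → Subset n → ℕ
  edges S T = ∑[ s < n ] (χ S s ℕ.* ∣ M s ∩ T ∣)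

  edges-∑∑ : ∀ S T → edges S T ≡ ∑[ s < n ] ∑[ t < n ] (χ S s ℕ.* (χ (M s) t ℕ.* χ T t))
  edges-∑∑ S T = sum-cong-≗ {n} λ s → trans
    (cong (χ S s ℕ.*_) (trans (∣p∣≡∑χ (M s ∩ T)) (sum-cong-≗ {n} (χ-∩ (M s) T))))
    (*-distribˡ-sum (χ S s) (λ t → χ (M s) t ℕ.* χ T t))

  ∑χ*k* : ∀ S T k → ∑[ s < n ] (χ S s ℕ.* (k ℕ.* ∣ M s ∩ T ∣)) ≡ k ℕ.* edges S T
  ∑χ*k* S T k = trans
    (sum-cong-≗ {n} λ s → x*[k*y] (χ S s) ∣ M s ∩ T ∣)
    (sym (*-distribˡ-sum {n} k λ s → χ S s ℕ.* ∣ M s ∩ T ∣))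
    where
    x*[k*y] : ∀ x y → x ℕ.* (k ℕ.* y) ≡ k ℕ.* (x ℕ.* y)
    x*[k*y] x y = trans (sym (ℕ.*-assoc x k y))
      (trans (cong (ℕ._* y) (ℕ.*-comm x k)) (ℕ.*-assoc k x y))

  module _ (M-sym : ∀ {u v} → u ∈ M v → v ∈ M u) where

    edges-comm : ∀ S T → edges S T ≡ edges T S
    edges-comm S T = begin
      edges S T
        ≡⟨ edges-∑∑ S T ⟩
      ∑[ s < n ] ∑[ t < n ] (χ S s ℕ.* (χ (M s) t ℕ.* χ T t))
        ≡⟨ ∑-comm (λ s t → χ S s ℕ.* (χ (M s) t ℕ.* χ T t)) ⟩
      ∑[ t < n ] ∑[ s < n ] (χ S s ℕ.* (χ (M s) t ℕ.* χ T t))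
        ≡⟨ (sum-cong-≗ {n} λ t → sum-cong-≗ {n} λ s → swap s t) ⟩
      ∑[ t < n ] ∑[ s < n ] (χ T t ℕ.* (χ (M t) s ℕ.* χ S s))
        ≡⟨ sym (edges-∑∑ T S) ⟩
      edges T S ∎
      where
      open ≡-Reasoning

      swap : ∀ s t → χ S s ℕ.* (χ (M s) t ℕ.* χ T t) ≡ χ T t ℕ.* (χ (M t) s ℕ.* χ S s)
      swap s t rewrite χ-sym {p = M s} {M t} {t} {s} M-sym M-sym = begin
        χ S s ℕ.* (χ (M t) s ℕ.* χ T t) ≡⟨ sym (ℕ.*-assoc (χ S s) (χ (M t) s) (χ T t)) ⟩
        χ S s ℕ.* χ (M t) s ℕ.* χ T t   ≡⟨ ℕ.*-comm _ (χ T t) ⟩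
        χ T t ℕ.* (χ S s ℕ.* χ (M t) s) ≡⟨ cong (χ T t ℕ.*_) (ℕ.*-comm (χ S s) _) ⟩
        χ T t ℕ.* (χ (M t) s ℕ.* χ S s) ∎

    -- Otherwise `k * ∣ M t ∩ S ∣ + 1 ≤ ∣ S ∣` for all `t ∈ T`, and summing over `T` gives
    -- `∣ T ∣ + k * edges T S ≤ ∣ T ∣ * ∣ S ∣`. Summing `dense` over `S` bounds the right side by
    -- `k * edges S T`, which is `k * edges T S`, so `T` would be empty.
    averaging : ∀ k (S T : Subset n) → Nonempty T →
                (∀ {s} → s ∈ S → ∣ T ∣ ℕ.≤ k ℕ.* ∣ M s ∩ T ∣) →
                ∃[ t ] (t ∈ T × ∣ S ∣ ℕ.≤ k ℕ.* ∣ M t ∩ S ∣)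
    averaging k S T T-nonempty dense
      with any? (λ t → (t ∈? T) ×-dec (∣ S ∣ ℕ.≤? k ℕ.* ∣ M t ∩ S ∣))
    ... | yes found = found
    ... | no  none  = contradiction ∣T∣≤0 (ℕ.<⇒≱ (nonempty⇒0<∣p∣ T-nonempty))
      where
      open ℕ.≤-Reasoning

      sparse : ∀ {t} → t ∈ T → suc (k ℕ.* ∣ M t ∩ S ∣) ℕ.≤ ∣ S ∣
      sparse t∈T = ℕ.≰⇒> λ h → none (_ , t∈T , h)

      ∣T∣≤0 : ∣ T ∣ ℕ.≤ 0
      -- The isolated summand `∣ T ∣` collects the 1 gained from each strict inequality in `sparse`.
      ∣T∣≤0 = ℕ.+-cancelʳ-≤ (k ℕ.* edges T S) ∣ T ∣ 0 (begin
        ∣ T ∣ ℕ.+ k ℕ.* edges T S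
          ≡⟨ cong₂ ℕ._+_ (sym (trans (∑χ*c T 1) (ℕ.*-identityʳ _))) (sym (∑χ*k* T S k)) ⟩
        ∑[ t < n ] (χ T t ℕ.* 1) ℕ.+ ∑[ t < n ] (χ T t ℕ.* (k ℕ.* ∣ M t ∩ S ∣))
          ≡⟨ sym (∑-distrib-+ {n} (λ t → χ T t ℕ.* 1) (λ t → χ T t ℕ.* (k ℕ.* ∣ M t ∩ S ∣))) ⟩
        ∑[ t < n ] (χ T t ℕ.* 1 ℕ.+ χ T t ℕ.* (k ℕ.* ∣ M t ∩ S ∣))
          ≡⟨ (sum-cong-≗ {n} λ t → sym (ℕ.*-distribˡ-+ (χ T t) 1 (k ℕ.* ∣ M t ∩ S ∣))) ⟩
        ∑[ t < n ] (χ T t ℕ.* suc (k ℕ.* ∣ M t ∩ S ∣))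
          ≤⟨ weighted-mono T sparse ⟩
        ∑[ t < n ] (χ T t ℕ.* ∣ S ∣)
          ≡⟨ ∑χ*c T ∣ S ∣ ⟩
        ∣ T ∣ ℕ.* ∣ S ∣
          ≡⟨ ℕ.*-comm ∣ T ∣ ∣ S ∣ ⟩
        ∣ S ∣ ℕ.* ∣ T ∣
          ≡⟨ sym (∑χ*c S ∣ T ∣) ⟩
        ∑[ s < n ] (χ S s ℕ.* ∣ T ∣)
          ≤⟨ weighted-mono S dense ⟩
        ∑[ s < n ] (χ S s ℕ.* (k ℕ.* ∣ M s ∩ T ∣))
          ≡⟨ ∑χ*k* S T k ⟩
        k ℕ.* edges S T
          ≡⟨ cong (k ℕ.*_) (edges-comm S T) ⟩
        k ℕ.* edges T S ∎)

-- Comparing rational and real numbers with integers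

<⇒≱ : ∀ {p q} → p ℚ.< q → ¬ q ℚ.≤ p
<⇒≱ p<q q≤p = ℚ.<-irrefl refl (ℚ.<-≤-trans p<q q≤p)

toℚᵘ-/ : ∀ a b → toℚᵘ (+ a ℚ./ suc b) ℚᵘ.≃ mkℚᵘ (+ a) b
toℚᵘ-/ a b = ℚ.toℚᵘ-fromℚᵘ (mkℚᵘ (+ a) b)

/-mono-≤ : ∀ a b c d .{{_ : NonZero b}} .{{_ : NonZero d}} →
           a ℕ.* d ℕ.≤ c ℕ.* b → + a ℚ./ b ℚ.≤ + c ℚ./ d
/-mono-≤ a (suc b) c (suc d) h = ℚ.toℚᵘ-cancel-≤ (begin
  toℚᵘ (+ a ℚ./ suc b)  ≃⟨ toℚᵘ-/ a b ⟩
  mkℚᵘ (+ a) b          ≤⟨ *≤* (subst₂ ℤ._≤_ (ℤ.pos-* a (suc d)) (ℤ.pos-* c (suc b)) (+≤+ h)) ⟩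
  mkℚᵘ (+ c) d          ≃⟨ ℚᵘ.≃-sym (toℚᵘ-/ c d) ⟩
  toℚᵘ (+ c ℚ./ suc d)  ∎)
  where open ℚᵘ.≤-Reasoning

/-mono-< : ∀ a b c d .{{_ : NonZero b}} .{{_ : NonZero d}} →
           a ℕ.* d ℕ.< c ℕ.* b → + a ℚ./ b ℚ.< + c ℚ./ d
/-mono-< a (suc b) c (suc d) h = ℚ.toℚᵘ-cancel-< (begin-strict
  toℚᵘ (+ a ℚ./ suc b)  ≃⟨ toℚᵘ-/ a b ⟩
  mkℚᵘ (+ a) b          <⟨ *<* (subst₂ ℤ._<_ (ℤ.pos-* a (suc d)) (ℤ.pos-* c (suc b)) (+<+ h)) ⟩
  mkℚᵘ (+ c) d          ≃⟨ ℚᵘ.≃-sym (toℚᵘ-/ c d) ⟩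
  toℚᵘ (+ c ℚ./ suc d)  ∎)
  where open ℚᵘ.≤-Reasoning

/-cancel-≤ : ∀ a b c d .{{_ : NonZero b}} .{{_ : NonZero d}} →
             + a ℚ./ b ℚ.≤ + c ℚ./ d → a ℕ.* d ℕ.≤ c ℕ.* b
/-cancel-≤ a b c d h = ℕ.≮⇒≥ λ lt → <⇒≱ (/-mono-< c d a b lt) h

/-*-/1 : ∀ a b m .{{_ : NonZero b}} → (+ a ℚ./ b) ℚ.* (+ m ℚ./ 1) ≡ + (a ℕ.* m) ℚ./ b
/-*-/1 a (suc b) m = ℚ.toℚᵘ-injective (begin
  toℚᵘ ((+ a ℚ./ suc b) ℚ.* (+ m ℚ./ 1))
    ≈⟨ ℚ.toℚᵘ-homo-* (+ a ℚ./ suc b) (+ m ℚ./ 1) ⟩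
  toℚᵘ (+ a ℚ./ suc b) ℚᵘ.* toℚᵘ (+ m ℚ./ 1)
    ≈⟨ ℚᵘ.*-cong (toℚᵘ-/ a b) (toℚᵘ-/ m 0) ⟩
  mkℚᵘ (+ a) b ℚᵘ.* mkℚᵘ (+ m) 0
    ≈⟨ *≡* (cong₂ ℤ._*_ (sym (ℤ.pos-* a m)) (cong +_ (sym (ℕ.*-identityʳ (suc b))))) ⟩
  mkℚᵘ (+ (a ℕ.* m)) b
    ≈⟨ ℚᵘ.≃-sym (toℚᵘ-/ (a ℕ.* m) b) ⟩
  toℚᵘ (+ (a ℕ.* m) ℚ./ suc b) ∎)
  where open import Relation.Binary.Reasoning.Setoid ℚᵘ.≃-setoid

/1-nonNeg : ∀ m → ℚ.NonNegative (+ m ℚ./ 1)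
/1-nonNeg m = ℚ.nonNegative (/-mono-≤ 0 1 m 1 ℕ.z≤n)

p≤p+ε : ∀ {p ε} → 0ℚ ℚ.< ε → p ℚ.≤ p ℚ.+ ε
p≤p+ε {p} ε>0 = subst₂ ℚ._≤_ (ℚ.+-identityʳ p) refl (ℚ.+-monoʳ-≤ p (ℚ.<⇒≤ ε>0))

p<q⇒0<q-p : ∀ {p q} → p ℚ.< q → 0ℚ ℚ.< q ℚ.- p
p<q⇒0<q-p {p} {q} p<q = subst₂ ℚ._<_ (ℚ.+-inverseʳ p) refl (ℚ.+-monoˡ-< (ℚ.- p) p<q)

p+[q-p]≡q : ∀ p q → p ℚ.+ (q ℚ.- p) ≡ q
p+[q-p]≡q = solve 2 (λ p q → p :+ (q :- p) := q) refl

-- A rational `r` strictly between `q` and `p` would refute the hypothesis at ε = `r - q`.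
≤-by-ε : ∀ {p q} → (∀ ε → 0ℚ ℚ.< ε → p ℚ.≤ q ℚ.+ ε) → p ℚ.≤ q
≤-by-ε {p} {q} h = ℚ.≮⇒≥ λ q<p →
  let r , q<r , r<p = ℚ.<-dense q<p
  in <⇒≱ r<p (subst (p ℚ.≤_) (p+[q-p]≡q q r) (h (r ℚ.- q) (p<q⇒0<q-p q<r)))

p≤∣p∣ : ∀ p → p ℚ.≤ ℚ.∣ p ∣
p≤∣p∣ p with ℚ.≤-total 0ℚ p
... | inj₁ 0≤p = ℚ.≤-reflexive (sym (ℚ.0≤p⇒∣p∣≡p 0≤p))
... | inj₂ p≤0 = ℚ.≤-trans p≤0 (ℚ.0≤∣p∣ p)

∣p-q∣<ε⇒p≤q+ε : ∀ p q {ε} → ℚ.∣ p ℚ.- q ∣ ℚ.< ε → p ℚ.≤ q ℚ.+ ε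
∣p-q∣<ε⇒p≤q+ε p q h = subst₂ ℚ._≤_ (p+[q-p]≡q q p) refl
  (ℚ.+-monoʳ-≤ q (ℚ.≤-trans (p≤∣p∣ (p ℚ.- q)) (ℚ.<⇒≤ h)))

∣p-q∣<ε⇒q≤p+ε : ∀ p q {ε} → ℚ.∣ p ℚ.- q ∣ ℚ.< ε → q ℚ.≤ p ℚ.+ ε
∣p-q∣<ε⇒q≤p+ε p q {ε} h = ∣p-q∣<ε⇒p≤q+ε q p
  (subst (ℚ._< ε) (trans (sym (ℚ.∣-p∣≡∣p∣ (p ℚ.- q)))
    (cong ℚ.∣_∣ (solve 2 (λ p q → :- (p :- q) := q :- p) refl p q))) h)

infix 4 _≼_

-- Stronger than `fromℚ p ≤ x`: the tail of the sequence lies above `p` with no ε of slack.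
_≼_ : ℚ → ℝ → Set
p ≼ x = ∃[ N ] (∀ n → N ℕ.≤ n → p ℚ.≤ seq x n)

≼⇒≤ : ∀ {p x m d} → p ≼ x → x * fromℕ m ≤ fromℕ d → p ℚ.* (+ m ℚ./ 1) ℚ.≤ + d ℚ./ 1
≼⇒≤ {p} {x} {m} (M , p≤x) xm≤d = ≤-by-ε λ ε ε>0 →
  let N , h = xm≤d ε ε>0
  in ℚ.≤-trans
       (ℚ.*-monoʳ-≤-nonNeg (+ m ℚ./ 1) {{/1-nonNeg m}} (p≤x (M ℕ.⊔ N) (ℕ.m≤m⊔n M N)))
       (h (M ℕ.⊔ N) (ℕ.m≤n⊔m M N))

-- At a late index `K` the rational maximum is attained by one of the two sequences, and this choice
-- is decidable. That sequence is then close to or above `r` at `K`, and by the Cauchy property it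
-- stays above `p`. The gap between `p` and `r` pays for both errors.
⊔-≼ : ∀ {p r} x y → p ℚ.< r → x ⊔ y ≃ fromℚ r → p ≼ x ⊎ p ≼ y
⊔-≼ {p} {r} x y p<r x⊔y≃r = larger
  where
  δ : ℚ
  -- Half the gap: one δ is lost in comparing with `r` at `K`, another in passing from `K` to later
  -- indices.
  δ = ½ ℚ.* (r ℚ.- p)

  δ>0 : 0ℚ ℚ.< δ
  δ>0 = subst (ℚ._< δ) (ℚ.*-zeroʳ ½) (ℚ.*-monoʳ-<-pos ½ (p<q⇒0<q-p p<r))

  p+2δ≡r : p ℚ.+ δ ℚ.+ δ ≡ r
  p+2δ≡r = solve 2 (λ p r → p :+ con ½ :* (r :- p) :+ con ½ :* (r :- p) := r) refl p r

  close⇒≼ : ∀ z → (k : ∃[ N ] (∀ m n → N ℕ.≤ m → N ℕ.≤ n → ℚ.∣ seq z m ℚ.- seq z n ∣ ℚ.< δ)) →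
         ∀ K → proj₁ k ℕ.≤ K → r ℚ.≤ seq z K ℚ.+ δ → p ≼ z
  close⇒≼ z (N , h) K N≤K r≤zK+δ = N , λ n N≤n → cancel (begin
    p ℚ.+ δ ℚ.+ δ          ≡⟨ p+2δ≡r ⟩
    r                      ≤⟨ r≤zK+δ ⟩
    seq z K ℚ.+ δ          ≤⟨ ℚ.+-monoˡ-≤ δ (∣p-q∣<ε⇒p≤q+ε (seq z K) (seq z n) (h K n N≤K N≤n)) ⟩
    seq z n ℚ.+ δ ℚ.+ δ    ∎)
    where
    open ℚ.≤-Reasoning

    cancel : ∀ {q} → p ℚ.+ δ ℚ.+ δ ℚ.≤ q ℚ.+ δ ℚ.+ δ → p ℚ.≤ q
    cancel {q} le = subst₂ ℚ._≤_ (back p) (back q) (ℚ.+-monoˡ-≤ (ℚ.- (δ ℚ.+ δ)) le)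
      where
      back : ∀ q → q ℚ.+ δ ℚ.+ δ ℚ.+ ℚ.- (δ ℚ.+ δ) ≡ q
      back q = solve 2 (λ q δ → q :+ δ :+ δ :+ :- (δ :+ δ) := q) refl q δ

  larger : p ≼ x ⊎ p ≼ y
  larger with x⊔y≃r δ δ>0 | cauchy x δ δ>0 | cauchy y δ δ>0
  ... | N , h | cx@(Nx , _) | cy@(Ny , _) with ℚ.⊔-sel (seq x K) (seq y K)
    where K = N ℕ.⊔ (Nx ℕ.⊔ Ny)
  ... | inj₁ eq = inj₁ (close⇒≼ x cx _ (ℕ.≤-trans (ℕ.m≤m⊔n Nx Ny) (ℕ.m≤n⊔m N _))
                    (subst (λ q → r ℚ.≤ q ℚ.+ δ) eq (∣p-q∣<ε⇒q≤p+ε (seq x _ ℚ.⊔ seq y _) r (h _ (ℕ.m≤m⊔n N _)))))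
  ... | inj₂ eq = inj₂ (close⇒≼ y cy _ (ℕ.≤-trans (ℕ.m≤n⊔m Nx Ny) (ℕ.m≤n⊔m N _))
                    (subst (λ q → r ℚ.≤ q ℚ.+ δ) eq (∣p-q∣<ε⇒q≤p+ε (seq x _ ℚ.⊔ seq y _) r (h _ (ℕ.m≤m⊔n N _)))))

fromℚ-mono : ∀ {p q} → p ℚ.≤ q → fromℚ p ≤ fromℚ q
fromℚ-mono p≤q ε ε>0 = 0 , λ _ _ → ℚ.≤-trans p≤q (p≤p+ε ε>0)

⊔≃⇒≤ˡ : ∀ {x y z} → x ⊔ y ≃ z → x ≤ z
⊔≃⇒≤ˡ {x} {y} {z} eq ε ε>0 = let N , h = eq ε ε>0 in N , λ n N≤n →
  ℚ.≤-trans (ℚ.p≤p⊔q (seq x n) (seq y n)) (∣p-q∣<ε⇒p≤q+ε (seq x n ℚ.⊔ seq y n) (seq z n) (h n N≤n))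

⊔≃⇒≤ʳ : ∀ {x y z} → x ⊔ y ≃ z → y ≤ z
⊔≃⇒≤ʳ {x} {y} {z} eq ε ε>0 = let N , h = eq ε ε>0 in N , λ n N≤n →
  ℚ.≤-trans (ℚ.p≤q⊔p (seq x n) (seq y n)) (∣p-q∣<ε⇒p≤q+ε (seq x n ℚ.⊔ seq y n) (seq z n) (h n N≤n))

1/k*m≤d : ∀ {k m d} .{{_ : NonZero k}} → m ℕ.≤ k ℕ.* d →
          (+ 1 ℚ./ k) ℚ.* (+ m ℚ./ 1) ℚ.≤ + d ℚ./ 1
1/k*m≤d {k} {m} {d} m≤kd = ℚ.≤-trans (ℚ.≤-reflexive (/-*-/1 1 k m))
  (/-mono-≤ (1 ℕ.* m) k d 1 (subst₂ ℕ._≤_ (m≡1*m*1 m) (ℕ.*-comm k d) m≤kd))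
  where
  m≡1*m*1 : ∀ m → m ≡ 1 ℕ.* m ℕ.* 1
  m≡1*m*1 m = sym (trans (ℕ.*-identityʳ (1 ℕ.* m)) (ℕ.*-identityˡ m))

≤1/k⇒*≤ : ∀ {k m d x} .{{_ : NonZero k}} → m ℕ.≤ k ℕ.* d →
          x ≤ 1/ℕ k → x * fromℕ m ≤ fromℕ d
≤1/k⇒*≤ {k} {m} {d} {x} m≤kd x≤1/k ε ε>0 = let N , h = x≤1/k ε′ ε′>0 in N , λ n N≤n → begin
  seq x n ℚ.* m/1                     ≤⟨ ℚ.*-monoʳ-≤-nonNeg m/1 {{/1-nonNeg m}} (h n N≤n) ⟩
  (1/k ℚ.+ ε′) ℚ.* m/1                ≡⟨ ℚ.*-distribʳ-+ m/1 1/k ε′ ⟩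
  1/k ℚ.* m/1 ℚ.+ ε′ ℚ.* m/1          ≤⟨ ℚ.+-mono-≤ (1/k*m≤d {k} {m} m≤kd) ε′m≤ε ⟩
  + d ℚ./ 1 ℚ.+ ε                     ∎
  where
  open ℚ.≤-Reasoning
  m/1 = + m ℚ./ 1
  1/k = + 1 ℚ./ k
  -- The denominator is `suc m` so that `m = 0` is allowed; `ε′ * m ≤ ε` still holds.
  i = + 1 ℚ./ suc m
  ε′ = ε ℚ.* i

  ε′>0 : 0ℚ ℚ.< ε′
  ε′>0 = subst (ℚ._< ε′) (ℚ.*-zeroʳ ε)
    (ℚ.*-monoʳ-<-pos ε {{ℚ.positive ε>0}} (/-mono-< 0 1 1 (suc m) (ℕ.s≤s ℕ.z≤n)))

  ε′m≤ε : ε′ ℚ.* m/1 ℚ.≤ ε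
  ε′m≤ε = begin
    ε ℚ.* i ℚ.* m/1    ≡⟨ ℚ.*-assoc ε i m/1 ⟩
    ε ℚ.* (i ℚ.* m/1)  ≤⟨ ℚ.*-monoˡ-≤-nonNeg ε {{ℚ.pos⇒nonNeg ε {{ℚ.positive ε>0}}}}
                           (1/k*m≤d {suc m} {m} {1} (subst (m ℕ.≤_) (sym (ℕ.*-identityʳ (suc m))) (ℕ.n≤1+n m))) ⟩
    ε ℚ.* 1ℚ           ≡⟨ ℚ.*-identityʳ ε ⟩
    ε                  ∎

*k≤1⇒≤1/k : ∀ {k d x} .{{_ : NonZero k}} → d ℕ.≤ 1 → x * fromℕ k ≤ fromℕ d → x ≤ 1/ℕ k
-- The hypothesis is used with tolerance `ε * k`, which becomes ε after cancelling `k`.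
*k≤1⇒≤1/k {k@(suc _)} {d} {x} d≤1 xk≤d ε ε>0 = let N , h = xk≤d (ε ℚ.* k/1) ε*k>0 in N , λ n N≤n →
  ℚ.*-cancelʳ-≤-pos k/1 (begin
    seq x n ℚ.* k/1                   ≤⟨ h n N≤n ⟩
    + d ℚ./ 1 ℚ.+ ε ℚ.* k/1           ≤⟨ ℚ.+-monoˡ-≤ (ε ℚ.* k/1) d≤1/k*k ⟩
    1/k ℚ.* k/1 ℚ.+ ε ℚ.* k/1         ≡⟨ sym (ℚ.*-distribʳ-+ k/1 1/k ε) ⟩
    (1/k ℚ.+ ε) ℚ.* k/1               ∎)
  where
  open ℚ.≤-Reasoning
  k/1 = + k ℚ./ 1
  1/k = + 1 ℚ./ k

  instance
    k/1-pos : ℚ.Positive k/1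
    k/1-pos = ℚ.positive (/-mono-< 0 1 k 1 (ℕ.s≤s ℕ.z≤n))

  ε*k>0 : 0ℚ ℚ.< ε ℚ.* k/1
  ε*k>0 = ℚ.positive⁻¹ _ {{ℚ.pos*pos⇒pos ε {{ℚ.positive ε>0}} k/1}}

  d≤1/k*k : + d ℚ./ 1 ℚ.≤ 1/k ℚ.* k/1
  d≤1/k*k = ℚ.≤-trans
    (/-mono-≤ d 1 (1 ℕ.* k) k (subst (d ℕ.* k ℕ.≤_) (sym (ℕ.*-identityʳ (1 ℕ.* k))) (ℕ.*-monoˡ-≤ k d≤1)))
    (ℚ.≤-reflexive (sym (/-*-/1 1 k k)))

-- s/(sk+1) lies below 1/k, and close enough to it not to be told apart by
-- integers below s.
below-1/k : (s k : ℕ) → ℚ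
below-1/k s k = + s ℚ./ suc (s ℕ.* k)

below-1/k-< : ∀ s k .{{_ : NonZero k}} → below-1/k s k ℚ.< + 1 ℚ./ k
below-1/k-< s k = /-mono-< s (suc (s ℕ.* k)) 1 k (ℕ.≤-reflexive (sym (ℕ.*-identityˡ _)))

-- If `k * d < m`, then `s * (k * d + 1) ≤ s * m ≤ d * (s * k + 1)`, hence `s ≤ d`. But `d ≤ k * d <
-- m < s`.
below-1/k-≤ : ∀ {s k m d} .{{_ : NonZero k}} → m ℕ.< s → below-1/k s k ℚ.* (+ m ℚ./ 1) ℚ.≤ + d ℚ./ 1 →
              m ℕ.≤ k ℕ.* d
below-1/k-≤ {s} {k} {m} {d} m<s h = ℕ.≮⇒≥ λ kd<m → contradiction (s≤d kd<m) (ℕ.<⇒≱ (d<s kd<m))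
  where
  open ℕ.≤-Reasoning

  sm≤d[sk+1] : s ℕ.* m ℕ.≤ d ℕ.* suc (s ℕ.* k)
  sm≤d[sk+1] = subst₂ ℕ._≤_ (ℕ.*-identityʳ (s ℕ.* m)) refl
    (/-cancel-≤ (s ℕ.* m) (suc (s ℕ.* k)) d 1 (subst₂ ℚ._≤_ (/-*-/1 s (suc (s ℕ.* k)) m) refl h))

  s≤d : k ℕ.* d ℕ.< m → s ℕ.≤ d
  s≤d kd<m = ℕ.+-cancelʳ-≤ (s ℕ.* (k ℕ.* d)) s d (begin
    s ℕ.+ s ℕ.* (k ℕ.* d)   ≡⟨ sym (ℕ.*-suc s (k ℕ.* d)) ⟩
    s ℕ.* suc (k ℕ.* d)     ≤⟨ ℕ.*-monoʳ-≤ s kd<m ⟩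
    s ℕ.* m                 ≤⟨ sm≤d[sk+1] ⟩
    d ℕ.* suc (s ℕ.* k)     ≡⟨ ℕ.*-suc d (s ℕ.* k) ⟩
    d ℕ.+ d ℕ.* (s ℕ.* k)   ≡⟨ cong (d ℕ.+_) (trans (ℕ.*-comm d _) (ℕ.*-assoc s k d)) ⟩
    d ℕ.+ s ℕ.* (k ℕ.* d)   ∎)

  d<s : k ℕ.* d ℕ.< m → d ℕ.< s
  d<s kd<m = ℕ.<-trans (ℕ.≤-<-trans (ℕ.m≤n*m d k) kd<m) m<s

-- If `d` were 0, the witness ε of `0ℝ < x` would satisfy `ε ≼ x`, forcing `ε * m ≤ 0`.
0<∧*≤⇒0< : ∀ {x m d} → 0ℝ < x → 0 ℕ.< m → x * fromℕ m ≤ fromℕ d → 0 ℕ.< d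
0<∧*≤⇒0< {x} {m} {suc d} _ _ _ = ℕ.s≤s ℕ.z≤n
0<∧*≤⇒0< {x} {m} {zero} (ε , ε>0 , N , h) m>0 xm≤0 = contradiction
  (≼⇒≤ {ε} {x} {m} {0} (N , λ n N≤n → subst₂ ℚ._≤_ (ℚ.+-identityˡ ε) refl (h n N≤n)) xm≤0)
  (<⇒≱ (ℚ.positive⁻¹ _ {{ℚ.pos*pos⇒pos ε {{ℚ.positive ε>0}} _ {{m/1-pos}}}}))
  where
  m/1-pos : ℚ.Positive (+ m ℚ./ 1)
  m/1-pos = ℚ.positive (/-mono-< 0 1 m 1 (subst (0 ℕ.<_) (sym (ℕ.*-identityʳ m)) m>0))

1/k∈⟨0,1] : ∀ k .{{_ : NonZero k}} → 1/ℕ k ∈⟨0,1]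
1/k∈⟨0,1] k@(suc _) =
  (1/k , /-mono-< 0 1 1 k (ℕ.s≤s ℕ.z≤n) , 0 , λ _ _ → ℚ.≤-reflexive (ℚ.+-identityˡ 1/k)) ,
  fromℚ-mono {1/k} {1ℚ} (/-mono-≤ 1 k 1 1 (ℕ.s≤s ℕ.z≤n))
  where 1/k = + 1 ℚ./ k

-- The lower bound

module _ {n} {P : Fin n → Set} (P? : Decidable P) where

  ∈-comprehension⁺ : ∀ {i} → P i → i ∈ tabulate (does ∘ P?)
  ∈-comprehension⁺ {i} p = lookup⇒[]= i _ (trans (lookup∘tabulate (does ∘ P?) i) (dec-true (P? i) p))

  ∈-comprehension⁻ : ∀ {i} → i ∈ tabulate (does ∘ P?) → P i
  ∈-comprehension⁻ {i} i∈ with P? i | trans (sym (lookup∘tabulate (does ∘ P?) i)) ([]=⇒lookup i∈)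
  ... | yes p | _ = p

0<∣p∣⇒nonempty : ∀ {n} (p : Subset n) → 0 ℕ.< ∣ p ∣ → Nonempty p
0<∣p∣⇒nonempty {n} p 0<∣p∣ with nonempty? p
... | yes p≢∅ = p≢∅
... | no  p≡∅ = contradiction
  (trans (cong ∣_∣ (Empty-unique p≡∅)) (∣⊥∣≡0 n)) (ℕ.>⇒≢ 0<∣p∣)

module _ {G : Graph} {A C : Subset (Graph.order G)}
         (disjoint : Empty (A ∩ C))
         (no-A-C-edges : ∀ {a c} → a ∈ A → c ∈ C → c ∉ Graph.N G a) where
  open Graph G

  -- Length 0 is excluded because `A` and `C` are disjoint, length 1 because no edge joins them.
  path⇒distance-2 : ∀ {a b c} → a ∈ A → b ∈ N a → c ∈ N b → c ∈ C → AtDistance G 2 a c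
  path⇒distance-2 {a} {b} {c} a∈A b∈Na c∈Nb c∈C = cons b∈Na (cons c∈Nb nil) , shortest
    where
    shortest : ∀ {ℓ} → ℓ ℕ.< 2 → ¬ Walk G ℓ a c
    shortest _ nil                           = disjoint (_ , x∈p∩q⁺ (a∈A , c∈C))
    shortest _ (cons c∈Na nil)               = no-A-C-edges a∈A c∈C c∈Na
    shortest (ℕ.s≤s (ℕ.s≤s ())) (cons _ (cons _ _))

module _ (G : Graph) where
  open Graph G

  snoc : ∀ {ℓ u v w} → Walk G ℓ u v → w ∈ N v → Walk G (suc ℓ) u w
  snoc nil        e = cons e nil
  snoc (cons f p) e = cons f (snoc p e)

  reverse : ∀ {ℓ u v} → Walk G ℓ u v → Walk G ℓ v u
  reverse nil        = nil
  reverse (cons e p) = snoc (reverse p) (symmetric e)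

  ∈N²⁺ : ∀ {u v} → AtDistance G 2 u v → v ∈ N² G u
  ∈N²⁺ {u} = ∈-comprehension⁺ (atDistance? G 2 u)

  ∈N²⁻ : ∀ {u v} → v ∈ N² G u → AtDistance G 2 u v
  ∈N²⁻ {u} = ∈-comprehension⁻ (atDistance? G 2 u)

  N²-symmetric : ∀ {u v} → u ∈ N² G v → v ∈ N² G u
  N²-symmetric u∈N²v with p , shortest ← ∈N²⁻ u∈N²v =
    ∈N²⁺ (reverse p , λ ℓ<2 → shortest ℓ<2 ∘ reverse)

≼⇒≤k*d : ∀ s k m d {x} .{{_ : NonZero k}} → m ℕ.< s → below-1/k s k ≼ x →
         x * fromℕ m ≤ fromℕ d → m ℕ.≤ k ℕ.* d
≼⇒≤k*d s k m d {x} m<s q≼x xm≤d =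
  below-1/k-≤ {s} {k} {m} {d} m<s (≼⇒≤ {below-1/k s k} {x} {m} {d} q≼x xm≤d)

module _ (k : ℕ) .{{_ : NonZero k}} (x y : ℝ) (x>0 : 0ℝ < x) (y>0 : 0ℝ < y)
         (G : Graph) (A B C : Subset (Graph.order G)) (constrained : Constrained G x y A B C)
         where
  open Graph G
  open Constrained constrained
  open Tripartition tripartition

  N∩⊆N²∩ : ∀ {a b} → a ∈ A → b ∈ N a → N b ∩ C ⊆ N² G a ∩ C
  N∩⊆N²∩ {a} {b} a∈A b∈Na c∈ with c∈Nb , c∈C ← x∈p∩q⁻ (N b) C c∈ =
    x∈p∩q⁺ (∈N²⁺ G (path⇒distance-2 A∩C-empty no-A-C-edges a∈A b∈Na c∈Nb c∈C) , c∈C)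

  -- Positivity of `x`, however small, yields one neighbour; with its counterpart for `y` below,
  -- this lets a path from `A` reach `C` whichever of the two densities is the large one.
  neighbour-in-B : ∀ {a} → a ∈ A → Nonempty (N a ∩ B)
  neighbour-in-B {a} a∈A = 0<∣p∣⇒nonempty (N a ∩ B)
    (0<∧*≤⇒0< {x} {∣ B ∣} {∣ N a ∩ B ∣} x>0 (nonempty⇒0<∣p∣ B-nonempty) (A-to-B a∈A))

  neighbour-in-C : ∀ {b} → b ∈ B → Nonempty (N b ∩ C)
  neighbour-in-C {b} b∈B = 0<∣p∣⇒nonempty (N b ∩ C)
    (0<∧*≤⇒0< {y} {∣ C ∣} {∣ N b ∩ C ∣} y>0 (nonempty⇒0<∣p∣ C-nonempty) (B-to-C b∈B))

  dense-A-B⇒good-vertex : (∀ {a} → a ∈ A → ∣ B ∣ ℕ.≤ k ℕ.* ∣ N a ∩ B ∣) →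
           ∃[ c ] (c ∈ C × ∣ A ∣ ℕ.≤ k ℕ.* ∣ N² G c ∩ A ∣)
  dense-A-B⇒good-vertex dense
    with b , b∈B , ∣A∣≤k*∣Nb∩A∣ ← averaging N symmetric k A B B-nonempty dense
    -- Any neighbour of `b` in `C` will do: each vertex of `N b ∩ A` reaches it through `b`.
    with c , c∈ ← neighbour-in-C b∈B
    with _ , c∈C ← x∈p∩q⁻ (N b) C c∈
    = c , c∈C , ℕ.≤-trans ∣A∣≤k*∣Nb∩A∣ (ℕ.*-monoʳ-≤ k (p⊆q⇒∣p∣≤∣q∣ N∩A⊆N²∩A))
    where
    N∩A⊆N²∩A : N b ∩ A ⊆ N² G c ∩ A
    N∩A⊆N²∩A a∈ with a∈Nb , a∈A ← x∈p∩q⁻ (N b) A a∈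
      with c∈N²a , _ ← x∈p∩q⁻ (N² G _) C (N∩⊆N²∩ a∈A (symmetric a∈Nb) c∈) =
      x∈p∩q⁺ (N²-symmetric G c∈N²a , a∈A)

  dense-B-C⇒good-vertex : (∀ {b} → b ∈ B → ∣ C ∣ ℕ.≤ k ℕ.* ∣ N b ∩ C ∣) →
           ∃[ c ] (c ∈ C × ∣ A ∣ ℕ.≤ k ℕ.* ∣ N² G c ∩ A ∣)
  -- The averaging runs over the relation of being at distance two, between `A` and `C`.
  dense-B-C⇒good-vertex dense = averaging (N² G) (N²-symmetric G) k A C C-nonempty dense²
    where
    dense² : ∀ {a} → a ∈ A → ∣ C ∣ ℕ.≤ k ℕ.* ∣ N² G a ∩ C ∣
    dense² {a} a∈A
      -- A single neighbour `b` suffices, as all of `N b ∩ C` is at distance two from `a`.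
      with b , b∈ ← neighbour-in-B a∈A
      with b∈Na , b∈B ← x∈p∩q⁻ (N a) B b∈
      = ℕ.≤-trans (dense b∈B) (ℕ.*-monoʳ-≤ k (p⊆q⇒∣p∣≤∣q∣ (N∩⊆N²∩ a∈A b∈Na)))

  good-vertex : x ⊔ y ≃ 1/ℕ k → ∃[ c ] (c ∈ C × ∣ A ∣ ℕ.≤ k ℕ.* ∣ N² G c ∩ A ∣)
  good-vertex x⊔y≃1/k = [ large-x , large-y ]′ (⊔-≼ x y (below-1/k-< s k) x⊔y≃1/k)
    where
    s : ℕ
    -- Exceeds both `∣ B ∣` and `∣ C ∣`, since it must be fixed before it is known whether `x` or
    -- `y` is large.
    s = suc (∣ B ∣ ℕ.+ ∣ C ∣)

    large-x : below-1/k s k ≼ x → ∃[ c ] (c ∈ C × ∣ A ∣ ℕ.≤ k ℕ.* ∣ N² G c ∩ A ∣)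
    large-x q≼x = dense-A-B⇒good-vertex λ {a} a∈A →
      ≼⇒≤k*d s k ∣ B ∣ ∣ N a ∩ B ∣ {x} (ℕ.s≤s (ℕ.m≤m+n ∣ B ∣ ∣ C ∣)) q≼x (A-to-B a∈A)

    large-y : below-1/k s k ≼ y → ∃[ c ] (c ∈ C × ∣ A ∣ ℕ.≤ k ℕ.* ∣ N² G c ∩ A ∣)
    large-y q≼y = dense-B-C⇒good-vertex λ {b} b∈B →
      ≼⇒≤k*d s k ∣ C ∣ ∣ N b ∩ C ∣ {y} (ℕ.s≤s (ℕ.m≤n+m ∣ C ∣ ∣ B ∣)) q≼y (B-to-C b∈B)

admissible-1/k : ∀ k .{{_ : NonZero k}} x y → 0ℝ < x → 0ℝ < y → x ⊔ y ≃ 1/ℕ k →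
                 Admissible x y (1/ℕ k)
admissible-1/k k x y x>0 y>0 x⊔y≃1/k G A B C constrained =
  let v , v∈C , h = good-vertex k x y x>0 y>0 G A B C constrained x⊔y≃1/k
  in v , v∈C , λ ε ε>0 → 0 , λ _ _ → ℚ.≤-trans (1/k*m≤d {k} {∣ A ∣} {∣ N² G v ∩ A ∣} h) (p≤p+ε ε>0)

-- The upper bound

-- Each entry is repeated `k` times in the order used by `combine`, so that membership depends on
-- the first coordinate only.
blowup : ∀ {m} k → Subset m → Subset (m ℕ.* k)
blowup k p = concat (map (replicate k) p)

lookup-blowup : ∀ {m} k (p : Subset m) i j → lookup (blowup k p) (combine i j) ≡ lookup p i
lookup-blowup k p i j = trans (lookup-concat (map (replicate k) p) i j)
  (trans (cong (λ v → lookup v j) (lookup-map i (replicate k) p)) (lookup-replicate j (lookup p i)))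

∣replicate++∣ : ∀ {n} k b (p : Subset n) → ∣ replicate k b ++ p ∣ ≡ ∣ b ∷ [] ∣ ℕ.* k ℕ.+ ∣ p ∣
∣replicate++∣ zero    true  p = refl
∣replicate++∣ zero    false p = refl
∣replicate++∣ (suc k) true  p = cong suc (∣replicate++∣ k true p)
∣replicate++∣ (suc k) false p = ∣replicate++∣ k false p

∣blowup∣ : ∀ {m} k (p : Subset m) → ∣ blowup k p ∣ ≡ ∣ p ∣ ℕ.* k
∣blowup∣ k []          = refl
∣blowup∣ k (true  ∷ p) = trans (∣replicate++∣ k true (blowup k p))
  (cong₂ ℕ._+_ (ℕ.*-identityˡ k) (∣blowup∣ k p))
∣blowup∣ k (false ∷ p) = trans (∣replicate++∣ k false (blowup k p)) (∣blowup∣ k p)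

-- The vertex combine i j is the i-th vertex of the j-th of k disjoint
-- three-vertex paths.
module Paths (k : ℕ) .{{_ : NonZero k}} where

  layer : Fin (3 ℕ.* k) → Fin 3
  layer v = proj₁ (remQuot k v)

  index : Fin (3 ℕ.* k) → Fin k
  index v = proj₂ (remQuot {3} k v)

  layer-combine : ∀ i j → layer (combine i j) ≡ i
  layer-combine i j = cong proj₁ (remQuot-combine {3} {k} i j)

  Adjacent : Fin (3 ℕ.* k) → Fin (3 ℕ.* k) → Set
  Adjacent u v = ℕ.∣ toℕ (layer u) - toℕ (layer v) ∣ ≡ 1 × index u ≡ index v

  adjacent? : ∀ u → Decidable (Adjacent u)
  adjacent? u v = (ℕ.∣ toℕ (layer u) - toℕ (layer v) ∣ ℕ.≟ 1) ×-dec (index u ≟ᶠ index v)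

  N : Fin (3 ℕ.* k) → Subset (3 ℕ.* k)
  N u = tabulate (does ∘ adjacent? u)

  N⁻ : ∀ {u v} → v ∈ N u → Adjacent u v
  N⁻ {u} = ∈-comprehension⁻ (adjacent? u)

  graph : Graph
  graph = record
    { order     = 3 ℕ.* k
    ; N         = N
    ; symmetric = λ {u} {v} u∈Nv → let d , i = N⁻ {v} u∈Nv in
        ∈-comprehension⁺ (adjacent? u) (trans (ℕ.∣-∣-comm (toℕ (layer u)) (toℕ (layer v))) d , sym i)
    ; loopless  = λ {v} v∈Nv → case trans (sym (ℕ.∣n-n∣≡0 (toℕ (layer v)))) (proj₁ (N⁻ {v} v∈Nv)) of λ ()
    }

  -- The layers 0, 1, 2 serve as `A`, `B`, `C`. Building them by `blowup` makes their size
  -- computable by induction.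
  L : Fin 3 → Subset (3 ℕ.* k)
  L i = blowup k ⁅ i ⁆

  ∣L∣ : ∀ i → ∣ L i ∣ ≡ k
  ∣L∣ i = trans (∣blowup∣ k ⁅ i ⁆) (trans (cong (ℕ._* k) (∣⁅x⁆∣≡1 i)) (ℕ.*-identityˡ k))

  lookup-L : ∀ i v → lookup (L i) v ≡ lookup ⁅ i ⁆ (layer v)
  lookup-L i v = trans (cong (lookup (L i)) (sym (combine-remQuot {3} k v)))
    (lookup-blowup k ⁅ i ⁆ (layer v) (index v))

  ∈L⁻ : ∀ i {v} → v ∈ L i → layer v ≡ i
  ∈L⁻ i {v} v∈ = x∈⁅y⁆⇒x≡y i
    (lookup⇒[]= (layer v) ⁅ i ⁆ (trans (sym (lookup-L i v)) ([]=⇒lookup v∈)))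

  ∈L⁺ : ∀ {i v} → layer v ≡ i → v ∈ L i
  ∈L⁺ {v = v} refl = lookup⇒[]= v _
    (trans (lookup-L (layer v) v) ([]=⇒lookup (x∈⁅x⁆ (layer v))))

  ∈L-combine : ∀ i j → combine i j ∈ L i
  ∈L-combine i j = ∈L⁺ {i} {combine i j} (layer-combine i j)

  L-nonempty : ∀ i → Nonempty (L i)
  L-nonempty i = 0<∣p∣⇒nonempty (L i) (subst (0 ℕ.<_) (sym (∣L∣ i)) (ℕ.>-nonZero⁻¹ k))

  L-disjoint : ∀ i j → i ≢ j → Empty (L i ∩ L j)
  L-disjoint i j i≢j (_ , v∈) with v∈i , v∈j ← x∈p∩q⁻ (L i) (L j) v∈ =
    i≢j (trans (sym (∈L⁻ i v∈i)) (∈L⁻ j v∈j))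

  L-cover : L 0F ∪ L 1F ∪ L 2F ≡ ⊤
  L-cover = ⊆-antisym ⊆⊤ λ {v} _ → covered v (layer v) refl
    where
    covered : ∀ v i → layer v ≡ i → v ∈ L 0F ∪ L 1F ∪ L 2F
    covered v 0F eq = x∈p∪q⁺ (inj₁ (∈L⁺ eq))
    covered v 1F eq = x∈p∪q⁺ (inj₂ (x∈p∪q⁺ (inj₁ (∈L⁺ eq))))
    covered v 2F eq = x∈p∪q⁺ (inj₂ (x∈p∪q⁺ (inj₂ (∈L⁺ eq))))

  -- Serves both stability (`i = j`) and the absence of edges between `A` and `C` (layers 0 and 2).
  layers-not-adjacent : ∀ i j {u v} → ℕ.∣ toℕ i - toℕ j ∣ ≢ 1 → u ∈ L i → v ∈ L j → v ∉ N u
  layers-not-adjacent i j {u} ≢1 u∈ v∈ v∈Nu with refl ← ∈L⁻ i u∈ | refl ← ∈L⁻ j v∈ =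
    ≢1 (proj₁ (N⁻ {u} v∈Nu))

  L-stable : ∀ i → Stable graph (L i)
  L-stable i = layers-not-adjacent i i λ eq →
    case trans (sym (ℕ.∣n-n∣≡0 (toℕ i))) eq of λ ()

  tripartition : Tripartition graph (L 0F) (L 1F) (L 2F)
  tripartition = record
    { A-nonempty = L-nonempty 0F ; B-nonempty = L-nonempty 1F ; C-nonempty = L-nonempty 2F
    ; A∩B-empty = L-disjoint 0F 1F λ () ; A∩C-empty = L-disjoint 0F 2F λ () ; B∩C-empty = L-disjoint 1F 2F λ ()
    ; cover = L-cover
    ; A-stable = L-stable 0F ; B-stable = L-stable 1F ; C-stable = L-stable 2F
    }

  neighbour-exists : ∀ i j {u} → ℕ.∣ toℕ i - toℕ j ∣ ≡ 1 → u ∈ L i → 0 ℕ.< ∣ N u ∩ L j ∣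
  neighbour-exists i j {u} ∣i-j∣≡1 u∈ with refl ← ∈L⁻ i u∈ =
    -- The witness is the vertex of layer `j` on the same path as `u`.
    nonempty⇒0<∣p∣ (combine j (index u) , x∈p∩q⁺
      ( ∈-comprehension⁺ (adjacent? u)
          ( trans (cong (λ l → ℕ.∣ toℕ (layer u) - toℕ l ∣) (layer-combine j (index u))) ∣i-j∣≡1
          , sym (cong proj₂ (remQuot-combine {3} {k} j (index u))))
      , ∈L-combine j (index u)))

  -- One neighbour in the next layer is enough, because that layer has `k` vertices and both
  -- densities are at most 1/k.
  constrained : ∀ x y → x ≤ 1/ℕ k → y ≤ 1/ℕ k →
                Constrained graph x y (L 0F) (L 1F) (L 2F)
  constrained x y x≤1/k y≤1/k = record
    { tripartition = tripartition
    ; A-to-B       = λ a∈ → ≤1/k⇒*≤ {k} {∣ L 1F ∣} {x = x} (∣L∣≤k*d 1F (neighbour-exists 0F 1F refl a∈)) x≤1/k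
    ; B-to-C       = λ b∈ → ≤1/k⇒*≤ {k} {∣ L 2F ∣} {x = y} (∣L∣≤k*d 2F (neighbour-exists 1F 2F refl b∈)) y≤1/k
    ; no-A-C-edges = layers-not-adjacent 0F 2F λ ()
    }
    where
    ∣L∣≤k*d : ∀ i {d} → 0 ℕ.< d → ∣ L i ∣ ℕ.≤ k ℕ.* d
    ∣L∣≤k*d i {d} d>0 = subst (ℕ._≤ k ℕ.* d) (sym (∣L∣ i)) (ℕ.m≤m*n k d {{ℕ.>-nonZero d>0}})

  walk⇒index-≡ : ∀ {ℓ u v} → Walk graph ℓ u v → index u ≡ index v
  walk⇒index-≡ nil                  = refl
  walk⇒index-≡ (cons {u = u} v∈Nu p) = trans (proj₂ (N⁻ {u} v∈Nu)) (walk⇒index-≡ p)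

  -- Walks preserve the index, so a vertex of layer `i` reachable from `v` has both coordinates
  -- determined.
  ∣N²∩L∣≤1 : ∀ v i → ∣ N² graph v ∩ L i ∣ ℕ.≤ 1
  ∣N²∩L∣≤1 v i = subst (∣ N² graph v ∩ L i ∣ ℕ.≤_) (∣⁅x⁆∣≡1 w) (p⊆q⇒∣p∣≤∣q∣ ⊆⁅w⁆)
    where
    w = combine i (index v)

    ⊆⁅w⁆ : N² graph v ∩ L i ⊆ ⁅ w ⁆
    ⊆⁅w⁆ {u} u∈ with u∈N² , u∈L ← x∈p∩q⁻ (N² graph v) (L i) u∈ =
      subst (_∈ ⁅ w ⁆) (sym u≡w) (x∈⁅x⁆ w)
      where
      u≡w : u ≡ w
      u≡w = trans (sym (combine-remQuot {3} k u))
        (cong₂ combine (∈L⁻ i u∈L) (sym (walk⇒index-≡ (proj₁ (∈N²⁻ graph u∈N²)))))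

admissible⇒≤1/k : ∀ k .{{_ : NonZero k}} x y z → x ≤ 1/ℕ k → y ≤ 1/ℕ k →
                  Admissible x y z → z ≤ 1/ℕ k
admissible⇒≤1/k k x y z x≤1/k y≤1/k admissible =
  let v , _ , z*∣A∣≤ = admissible graph (L 0F) (L 1F) (L 2F) (constrained x y x≤1/k y≤1/k)
      d = ∣ N² graph v ∩ L 0F ∣
  -- Here `A` has exactly `k` vertices and `d ≤ 1`, so `z * k ≤ 1`.
  in *k≤1⇒≤1/k {k} {d} {z} (∣N²∩L∣≤1 v 0F)
       (subst (λ m → z * fromℕ m ≤ fromℕ d) (∣L∣ 0F) z*∣A∣≤)
  where open Paths k

mainTheorem4 : (k : ℕ) .{{_ : NonZero k}} (x y : ℝ) →
    0ℝ < x → 0ℝ < y → x ⊔ y ≃ 1/ℕ k → φ[ x , y ]≡ 1/ℕ k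
mainTheorem4 k x y x>0 y>0 x⊔y≃1/k = record
  { in-range   = 1/k∈⟨0,1] k
  ; admissible = admissible-1/k k x y x>0 y>0 x⊔y≃1/k
  ; maximal    = λ z _ → admissible⇒≤1/k k x y z (⊔≃⇒≤ˡ {x} {y} {1/ℕ k} x⊔y≃1/k) (⊔≃⇒≤ʳ {x} {y} {1/ℕ k} x⊔y≃1/k)
  }
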